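{- Let $\mathcal{M}$ be a structure in which all finite sets $\Phi(x;y)$ of formulas with $|x|=1$ admit a distal cell decomposition with $k$ parameters, and suppose that for some $d_0\in\mathbb{N}$, all finite sets $\Phi(x;y)$ of formulas with $|x|=d_0$ admit distal cell decompositions of exponent at most $r$. Then all finite sets $\Phi(x;y)$ of formulas with $|x|=d\ge d_0$ admit distal cell decompositions of exponent $k(d-d_0)+r$.
   Context: Let $\mathcal{M}$ be a first-order structure with universe $M$ in a language $\mathcal{L}$. Formulas are $\mathcal{L}$-formulas without parameters. In a partitioned formula $\varphi(x;y)$ the variables are split into finite tuples $x,y$ of lengths $|x|,|y|$ ($y$ is of arbitrary length); all formulas in a set $\Phi(x;y)$ share the same $x$ and $y$. For $b\in M^{|y|}$ put $\varphi(M^{|x|};b)=\{a\in M^{|x|}:\mathcal{M}\models\varphi(a,b)\}$. For $B\subseteq M^{|y|}$, a set $X\subseteq M^{|x|}$ is crossed by $\Phi(x;B)$ if for some $\varphi\in\Phi$, $b\in B$ both $X\cap\varphi(M^{|x|};b)$ and $X\setminus\varphi(M^{|x|};b)$ are nonempty. A distal cell decomposition $\mathcal{T}$ for a finite set $\Phi(x;y)$ is given by a finite set $\Psi(x;y_1,\dots,y_k)$ of formulas with $|y_1|=\dots=|y_k|=|y|$ and, for each $\psi\in\Psi$, a formula $\theta_\psi(y;y_1,\dots,y_k)$ such that for each finite nonempty $B\subseteq M^{|y|}$ the following holds. Let $\mathcal{T}(B)$ be the set of all $\Delta=\psi(M^{|x|};b_1,\dots,b_k)$ with $\psi\in\Psi$,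 $b_1,\dots,b_k\in B$, such that no $b\in B$ satisfies $\theta_\psi(b;b_1,\dots,b_k)$. Then $\bigcup\mathcal{T}(B)=M^{|x|}$ and no element of $\mathcal{T}(B)$ is crossed by $\Phi(x;B)$. $\mathcal{T}$ has $k$ parameters if every formula in $\Psi$ is of the form $\psi(x;y_1,\dots,y_k)$ (with this $k$). $\mathcal{T}$ has exponent $r$ if there is $C$ with $|\mathcal{T}(B)|\le C|B|^r$ for all finite nonempty $B\subseteq M^{|y|}$. In the hypotheses the numbers $k$, $d_0$, $r$ do not depend on $\Phi$. -}

module Defs where

open import Level using (Level; _⊔_) renaming (suc to lsuc)
open import Data.Empty.Polymorphic using (⊥)
open import Data.Fin.Base using (Fin)
open import Data.Integer.Base using (+_; _⊖_)
open import Data.List.Base using (List; []; length)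
open import Data.List.Membership.Propositional using (_∈_)
open import Data.List.Relation.Unary.Unique.Propositional using (Unique)
open import Data.Nat.Base using (ℕ; suc; NonZero; _+_; _*_; _^_; _≤_)
open import Data.Product.Base using (Σ-syntax; ∃-syntax; _×_; _,_)
open import Data.Rational.Base as ℚ using (ℚ; _/_)
import Data.Rational.Properties as ℚ
open import Data.Sum.Base using (_⊎_)
open import Data.Vec.Base using (Vec; []; _∷_; _++_; concat; lookup)
open import Data.Vec.Relation.Unary.All using (All)
open import Function.Definitions using (Injective)
open import Relation.Binary.PropositionalEquality
open import Relation.Nullary.Negation using (¬_)
open import Relation.Unary using (Pred; _≐_; _∩_; _∖_; Satisfiable)

private
  variable
    ℓ a : Level
    n : ℕ

record Language (ℓ : Level) : Set (lsuc ℓ) where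
  field
    Func : ℕ → Set ℓ
    Rel  : ℕ → Set ℓ

module _ (𝓛 : Language ℓ) where
  open Language 𝓛

  data Term (n : ℕ) : Set ℓ where
    var  : Fin n → Term n
    func : ∀ {j} → Func j → Vec (Term n) j → Term n

  -- Formulas whose free variables are among n many; the quantifiers bind
  -- variable zero of their body.
  data Formula (n : ℕ) : Set ℓ where
    rel                  : ∀ {j} → Rel j → Vec (Term n) j → Formula n
    _≈′_                 : Term n → Term n → Formula n
    ⊥′                   : Formula n
    ¬′_                  : Formula n → Formula n
    _∧′_ _∨′_ _⇒′_       : Formula n → Formula n → Formula n
    ∀′_ ∃′_              : Formula (suc n) → Formula n

record Structure (𝓛 : Language ℓ) (a : Level) : Set (ℓ ⊔ lsuc a) where
  open Language 𝓛
  field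
    Universe : Set a
    funcᴹ    : ∀ {j} → Func j → Vec Universe j → Universe
    relᴹ     : ∀ {j} → Rel j → Pred (Vec Universe j) a

module _ {𝓛 : Language ℓ} (𝓜 : Structure 𝓛 a) where
  open Structure 𝓜

  mutual
    eval : Vec Universe n → Term 𝓛 n → Universe
    eval ρ (var i)     = lookup ρ i
    eval ρ (func f ts) = funcᴹ f (evals ρ ts)

    evals : ∀ {j} → Vec Universe n → Vec (Term 𝓛 n) j → Vec Universe j
    evals ρ []       = []
    evals ρ (t ∷ ts) = eval ρ t ∷ evals ρ ts

  _⊨_ : Vec Universe n → Formula 𝓛 n → Set a
  ρ ⊨ rel R ts = relᴹ R (evals ρ ts)
  ρ ⊨ (s ≈′ t) = eval ρ s ≡ eval ρ t
  ρ ⊨ ⊥′       = ⊥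
  ρ ⊨ (¬′ φ)   = ¬ (ρ ⊨ φ)
  ρ ⊨ (φ ∧′ χ) = (ρ ⊨ φ) × (ρ ⊨ χ)
  ρ ⊨ (φ ∨′ χ) = (ρ ⊨ φ) ⊎ (ρ ⊨ χ)
  ρ ⊨ (φ ⇒′ χ) = (ρ ⊨ φ) → (ρ ⊨ χ)
  ρ ⊨ (∀′ φ)   = ∀ m → (m ∷ ρ) ⊨ φ
  ρ ⊨ (∃′ φ)   = ∃[ m ] ((m ∷ ρ) ⊨ φ)

-- Two-sided Dedekind cuts: Lower q means q < r and Upper q means r < q.
record ℝ : Set₁ where
  field
    Lower Upper     : ℚ → Set
    lower-inhabited : ∃[ q ] Lower q
    upper-inhabited : ∃[ q ] Upper q
    lower-closed    : ∀ {p q} → p ℚ.< q → Lower q → Lower p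
    upper-closed    : ∀ {p q} → p ℚ.< q → Upper p → Upper q
    lower-open      : ∀ {p} → Lower p → ∃[ q ] (p ℚ.< q × Lower q)
    upper-open      : ∀ {q} → Upper q → ∃[ p ] (p ℚ.< q × Upper p)
    disjoint        : ∀ {q} → Lower q → ¬ Upper q
    located         : ∀ {p q} → p ℚ.< q → Lower p ⊎ Upper q

open ℝ

_≤ʳ_ : ℝ → ℝ → Set
r ≤ʳ s = ∀ {q} → Lower r q → Lower s q

private
  fromℕ : ℕ → ℚ
  fromℕ N = + N / 1

  +-∸ : ∀ q s → (q ℚ.+ s) ℚ.- s ≡ q
  +-∸ q s = trans (ℚ.+-assoc q s (ℚ.- s))
            (trans (cong (q ℚ.+_) (ℚ.+-inverseʳ s)) (ℚ.+-identityʳ q))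

  ∸-+ : ∀ q s → (q ℚ.- s) ℚ.+ s ≡ q
  ∸-+ q s = trans (ℚ.+-assoc q (ℚ.- s) s)
            (trans (cong (q ℚ.+_) (ℚ.+-inverseˡ s)) (ℚ.+-identityʳ q))

-- The real number N + r for a natural number N.
_+ʳ_ : ℕ → ℝ → ℝ
N +ʳ r = record
  { Lower           = λ q → Lower r (q ℚ.- s)
  ; Upper           = λ q → Upper r (q ℚ.- s)
  ; lower-inhabited = let q , l = lower-inhabited r in
                      q ℚ.+ s , subst (Lower r) (sym (+-∸ q s)) l
  ; upper-inhabited = let q , u = upper-inhabited r in
                      q ℚ.+ s , subst (Upper r) (sym (+-∸ q s)) u
  ; lower-closed    = λ p<q → lower-closed r (shift p<q)
  ; upper-closed    = λ p<q → upper-closed r (shift p<q)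
  ; lower-open      = λ {p} l → let q , p<q , l′ = lower-open r l in
                      q ℚ.+ s
                      , subst (ℚ._< q ℚ.+ s) (∸-+ p s) (ℚ.+-monoˡ-< s p<q)
                      , subst (Lower r) (sym (+-∸ q s)) l′
  ; upper-open      = λ {q} u → let p , p<q , u′ = upper-open r u in
                      p ℚ.+ s
                      , subst (p ℚ.+ s ℚ.<_) (∸-+ q s) (ℚ.+-monoˡ-< s p<q)
                      , subst (Upper r) (sym (+-∸ p s)) u′
  ; disjoint        = disjoint r
  ; located         = λ p<q → located r (shift p<q)
  }
  where
  s : ℚ
  s = fromℕ N

  shift : ∀ {p q} → p ℚ.< q → p ℚ.- s ℚ.< q ℚ.- s
  shift = ℚ.+-monoˡ-< (ℚ.- s)

-- t ≤ C · m ^ r for a real exponent r and m ≥ 1.  Since s ↦ m ^ s is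
-- continuous and nondecreasing, this says t ≤ C · m ^ s for all rational
-- s > r.  Writing s = (u - v) / w with natural numbers u, v and w ≥ 1 and
-- raising to the power w turns the latter into t ^ w · m ^ v ≤ C ^ w · m ^ u.
_≤_·_^ʳ_ : ℕ → ℕ → ℕ → ℝ → Set
t ≤ C · m ^ʳ r = ∀ (u v w : ℕ) .{{_ : NonZero w}} →
  Upper r ((u ⊖ v) / w) → t ^ w * m ^ v ≤ C ^ w * m ^ u

-- |𝒮| ≤ t for a family 𝒮 of subsets of A, counted up to extensional equality:
-- t subsets suffice to list 𝒮.  (The exact cardinality of a family of definable
-- sets is not available constructively, as their equality is undecidable.)
CardinalityAtMost : {A : Set a} → Pred (Pred A a) a → ℕ → Set (lsuc a)
CardinalityAtMost {a = a} {A = A} 𝒮 t =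
  Σ[ Xs ∈ Vec (Pred A a) t ] (∀ Δ → 𝒮 Δ → ∃[ i ] (Δ ≐ lookup Xs i))

-- A partitioned formula φ(x; y) with |x| = d and |y| = e is a formula in d + e
-- variables, those of x coming first.  A finite subset B of M^e is a
-- duplicate-free list, so that |B| is its length.
module _ {𝓛 : Language ℓ} (𝓜 : Structure 𝓛 a) (d e : ℕ) where
  open Structure 𝓜 renaming (Universe to M)

  -- The set φ(M^d; b), for b of any length.
  _⟦_⟧ : Formula 𝓛 (d + n) → Vec M n → Pred (Vec M d) a
  (φ ⟦ b ⟧) x = _⊨_ 𝓜 (x ++ b) φ

  Crossed : List (Formula 𝓛 (d + e)) → List (Vec M e) → Pred (Vec M d) a →
            Set (ℓ ⊔ a)
  Crossed Φ B X = ∃[ φ ] ∃[ b ] (φ ∈ Φ × b ∈ B ×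
    Satisfiable (X ∩ φ ⟦ b ⟧) × Satisfiable (X ∖ φ ⟦ b ⟧))

  -- The finite set Ψ is enumerated without repetition by ψ; the formula θ_ψ
  -- belonging to ψ i is θ i.
  record CellScheme : Set ℓ where
    field
      parameters  : ℕ
      size        : ℕ
      ψ           : Fin size → Formula 𝓛 (d + parameters * e)
      ψ-injective : Injective _≡_ _≡_ ψ
      θ           : Fin size → Formula 𝓛 (e + parameters * e)

    -- 𝒯(B), closed under extensional equality of subsets.
    cells : List (Vec M e) → Pred (Pred (Vec M d) a) a
    cells B Δ = Σ[ i ∈ Fin size ] Σ[ bs ∈ Vec (Vec M e) parameters ]
      ( All (_∈ B) bs
      × (∀ b → b ∈ B → ¬ _⊨_ 𝓜 (b ++ concat bs) (θ i))
      × Δ ≐ ψ i ⟦ concat bs ⟧ )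

  record DistalCellDecomposition (Φ : List (Formula 𝓛 (d + e))) :
         Set (ℓ ⊔ lsuc a) where
    field
      scheme : CellScheme

    open CellScheme scheme public

    field
      covers    : ∀ B → Unique B → B ≢ [] →
                  ∀ x → ∃[ Δ ] (cells B Δ × Δ x)
      uncrossed : ∀ B → Unique B → B ≢ [] →
                  ∀ Δ → cells B Δ → ¬ Crossed Φ B Δ

  module _ {Φ : List (Formula 𝓛 (d + e))} (T : DistalCellDecomposition Φ) where
    open DistalCellDecomposition T

    HasParameters : ℕ → Set
    HasParameters k = parameters ≡ k

    HasExponent : ℝ → Set (lsuc a)
    HasExponent r = ∃[ C ] (∀ B → Unique B → B ≢ [] →
      ∃[ t ] (CardinalityAtMost (cells B) t × t ≤ C · length B ^ʳ r))

    HasExponentAtMost : ℝ → Set (lsuc a)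
    HasExponentAtMost r = ∃[ r′ ] (r′ ≤ʳ r × HasExponent r′)

{-# OPTIONS --safe #-}
module Submission where

-- Adding one coordinate costs a factor |B|^k. Write points of M^(1+d) as (x, x′). Over a fixed x′
-- the formulas Φ(x; x′, y) have a one-variable decomposition whose cells ψᵢ(M; (x′,b₁),…,(x′,bₖ))
-- use k-tuples b̄ from B. For each b̄, decompose M^d for the formulas θᵢ and ∃x (ψᵢ ∧ φ) in
-- (x′; y, ȳ), evaluated on {(b, b̄) : b ∈ B}: on a cell Δ′ of this decomposition, being kept as a
-- fibre cell and meeting φ(–; b) do not depend on x′, so the cylinder
-- {(x, x′) : x′ ∈ Δ′, ψᵢ(x; x′, b̄)} is uncrossed. There are finitely many i and |B|^k tuples b̄.

open import Defs
open import Data.Fin.Base using (Fin; zero; suc; toℕ; _↑ˡ_; _↑ʳ_; combine; remQuot)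
open import Data.Fin.Properties using (remQuot-combine; toℕ-injective)
open import Data.Integer.Base as ℤ using (+_; _⊖_)
import Data.Integer.Properties as ℤ
open import Data.Integer.Tactic.RingSolver using () renaming (solve-∀ to ℤ-solve-∀)
open import Data.List.Base as List
  using (List; []; _∷_; length; allFin; cartesianProduct; cartesianProductWith)
import Data.List.Properties as List
open import Data.List.Membership.Propositional using (_∈_)
open import Data.List.Membership.Propositional.Properties
open import Data.List.Relation.Unary.Any using (here; there)
open import Data.List.Relation.Unary.Unique.Propositional using (Unique)
import Data.List.Relation.Unary.Unique.Propositional.Properties as Unique
open import Data.Nat.Base using (ℕ; zero; suc; _+_; _*_; _∸_; _^_; _≤_; _⊔_; z≤n; NonZero)
open import Data.Nat.Properties
open import Data.Nat.Tactic.RingSolver using () renaming (solve-∀ to ℕ-solve-∀)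
open import Data.Product.Base using (Σ-syntax; ∃-syntax; _×_; _,_; proj₁; proj₂; map₁; map₂)
open import Data.Product.Function.NonDependent.Propositional using (_×-⇔_)
open import Data.Rational.Base as ℚ using (_/_)
import Data.Rational.Properties as ℚ
open import Data.Rational.Unnormalised.Base as ℚᵘ using (mkℚᵘ; *≡*)
import Data.Rational.Unnormalised.Properties as ℚᵘ
open import Data.Sum.Base using (_⊎_; inj₁; inj₂)
open import Data.Sum.Function.Propositional using (_⊎-⇔_)
open import Data.Vec.Base as Vec
  using (Vec; []; _∷_; _++_; concat; lookup; map; head; tail; take; drop)
open import Data.Vec.Properties using (lookup-map; map-∘; map-cong; map-++; map-concat;
  map-lookup-allFin; lookup-++ˡ; lookup-++ʳ; ++-injectiveˡ; ++-injectiveʳ; take-map; drop-map; take++drop≡id)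
open import Data.Vec.Relation.Unary.All as All using (All; []; _∷_)
import Data.Vec.Relation.Unary.All.Properties as All
open import Function.Base using (_∘_; id)
open import Function.Bundles using (_⇔_; mk⇔; Equivalence)
open import Function.Construct.Identity using (⇔-id)
open import Function.Construct.Composition using (_⇔-∘_)
open import Function.Related.TypeIsomorphisms using (→-cong-⇔; ¬-cong-⇔)
open import Level using (Level)
open import Relation.Binary.PropositionalEquality
open import Relation.Nullary.Negation using (¬_; contradiction)
open import Relation.Unary using (Pred; _≐_)

open Equivalence using (to; from)

-- Renaming variables and quantifying over blocks of variables.

≡⇒⇔ : ∀ {b} {A B : Set b} → A ≡ B → A ⇔ B
≡⇒⇔ refl = ⇔-id _

lift : ∀ {m n} → Vec (Fin n) m → Vec (Fin (suc n)) (suc m)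
lift σ = zero ∷ map suc σ

module _ {ℓ : Level} {𝓛 : Language ℓ} where

  mutual
    renameᵗ : ∀ {m n} → Vec (Fin n) m → Term 𝓛 m → Term 𝓛 n
    renameᵗ σ (var i)     = var (lookup σ i)
    renameᵗ σ (func f ts) = func f (renameᵗˢ σ ts)

    renameᵗˢ : ∀ {m n j} → Vec (Fin n) m → Vec (Term 𝓛 m) j → Vec (Term 𝓛 n) j
    renameᵗˢ σ []       = []
    renameᵗˢ σ (t ∷ ts) = renameᵗ σ t ∷ renameᵗˢ σ ts

  -- A renaming is a vector of variables, so that composing it with an assignment is
  -- `map (lookup ρ) σ`, which commutes with `_++_` and `concat`.
  rename : ∀ {m n} → Vec (Fin n) m → Formula 𝓛 m → Formula 𝓛 n
  rename σ (rel R ts) = rel R (renameᵗˢ σ ts)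
  rename σ (s ≈′ t)   = renameᵗ σ s ≈′ renameᵗ σ t
  rename σ ⊥′         = ⊥′
  rename σ (¬′ φ)     = ¬′ rename σ φ
  rename σ (φ ∧′ χ)   = rename σ φ ∧′ rename σ χ
  rename σ (φ ∨′ χ)   = rename σ φ ∨′ rename σ χ
  rename σ (φ ⇒′ χ)   = rename σ φ ⇒′ rename σ χ
  rename σ (∀′ φ)     = ∀′ rename (lift σ) φ
  rename σ (∃′ φ)     = ∃′ rename (lift σ) φ

  ∃′* : ∀ d {n} → Formula 𝓛 (d + n) → Formula 𝓛 n
  ∃′* zero    φ = φ
  ∃′* (suc d) φ = ∃′* d (∃′ φ)

  -- Conjoined to the formulas of the new scheme to keep them distinct, since renaming variables
  -- non-injectively can identify different formulas.
  tautology : ∀ {n} → ℕ → Formula 𝓛 n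
  tautology zero    = ¬′ ⊥′
  tautology (suc m) = ⊥′ ⇒′ tautology m

  tautology-injective : ∀ {n} l m → tautology {n} l ≡ tautology m → l ≡ m
  tautology-injective zero    zero    _  = refl
  tautology-injective (suc l) (suc m) eq = cong suc (tautology-injective l m (⇒′-injectiveʳ eq))
    where
    ⇒′-injectiveʳ : ∀ {n} {φ φ′ χ χ′ : Formula 𝓛 n} → (φ ⇒′ χ) ≡ (φ′ ⇒′ χ′) → χ ≡ χ′
    ⇒′-injectiveʳ refl = refl

  ∧′-injectiveˡ : ∀ {n} {φ φ′ χ χ′ : Formula 𝓛 n} → (φ ∧′ χ) ≡ (φ′ ∧′ χ′) → φ ≡ φ′
  ∧′-injectiveˡ refl = refl

module _ {ℓ a : Level} {𝓛 : Language ℓ} (𝓜 : Structure 𝓛 a) where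
  open Structure 𝓜 renaming (Universe to M)

  private
    infix 4 _⊩_
    _⊩_ : ∀ {n} → Vec M n → Formula 𝓛 n → Set a
    _⊩_ = _⊨_ 𝓜

  mutual
    eval-rename : ∀ {m n} (ρ : Vec M n) (σ : Vec (Fin n) m) t →
      eval 𝓜 ρ (renameᵗ σ t) ≡ eval 𝓜 (map (lookup ρ) σ) t
    eval-rename ρ σ (var i)     = sym (lookup-map i (lookup ρ) σ)
    eval-rename ρ σ (func f ts) = cong (funcᴹ f) (evals-rename ρ σ ts)

    evals-rename : ∀ {m n j} (ρ : Vec M n) (σ : Vec (Fin n) m) (ts : Vec _ j) →
      evals 𝓜 ρ (renameᵗˢ σ ts) ≡ evals 𝓜 (map (lookup ρ) σ) ts
    evals-rename ρ σ []       = refl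
    evals-rename ρ σ (t ∷ ts) = cong₂ _∷_ (eval-rename ρ σ t) (evals-rename ρ σ ts)

  -- The composed assignment is a variable `ρ′` tied by an equation: callers choose its form, and
  -- the quantifier cases extend it by `m`.
  ⊨-rename : ∀ {m n} {ρ : Vec M n} {σ : Vec (Fin n) m} {ρ′} → map (lookup ρ) σ ≡ ρ′ →
    ∀ φ → ρ ⊩ rename σ φ ⇔ ρ′ ⊩ φ
  ⊨-rename {ρ = ρ} {σ} refl (rel R ts) = ≡⇒⇔ (cong (relᴹ R) (evals-rename ρ σ ts))
  ⊨-rename {ρ = ρ} {σ} refl (s ≈′ t)   = ≡⇒⇔ (cong₂ _≡_ (eval-rename ρ σ s) (eval-rename ρ σ t))
  ⊨-rename eq ⊥′       = ⇔-id _
  ⊨-rename eq (¬′ φ)   = ¬-cong-⇔ (⊨-rename eq φ)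
  ⊨-rename eq (φ ∧′ χ) = ⊨-rename eq φ ×-⇔ ⊨-rename eq χ
  ⊨-rename eq (φ ∨′ χ) = ⊨-rename eq φ ⊎-⇔ ⊨-rename eq χ
  ⊨-rename eq (φ ⇒′ χ) = →-cong-⇔ (⊨-rename eq φ) (⊨-rename eq χ)
  ⊨-rename {ρ = ρ} {σ} {ρ′} eq (∀′ φ) =
    mk⇔ (λ h m → to (body m) (h m)) (λ h m → from (body m) (h m))
    where
    body : ∀ m → (m ∷ ρ) ⊩ rename (lift σ) φ ⇔ (m ∷ ρ′) ⊩ φ
    body m = ⊨-rename (cong (m ∷_) (trans (sym (map-∘ (lookup (m ∷ ρ)) suc σ)) eq)) φ
  ⊨-rename {ρ = ρ} {σ} {ρ′} eq (∃′ φ) =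
    mk⇔ (map₂ λ {m} → to (body m)) (map₂ λ {m} → from (body m))
    where
    body : ∀ m → (m ∷ ρ) ⊩ rename (lift σ) φ ⇔ (m ∷ ρ′) ⊩ φ
    body m = ⊨-rename (cong (m ∷_) (trans (sym (map-∘ (lookup (m ∷ ρ)) suc σ)) eq)) φ

  ⊨-∃′* : ∀ d {n} {ρ : Vec M n} φ → ρ ⊩ ∃′* d φ ⇔ (∃[ xs ] (xs ++ ρ) ⊩ φ)
  ⊨-∃′* zero    φ = mk⇔ ([] ,_) λ { ([] , h) → h }
  ⊨-∃′* (suc d) φ =
    mk⇔ (λ { (xs , x , h) → x ∷ xs , h }) (λ { (x ∷ xs , h) → xs , x , h }) ⇔-∘ ⊨-∃′* d (∃′ φ)

  ⊨-tautology : ∀ {n} {ρ : Vec M n} m → ρ ⊩ tautology m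
  ⊨-tautology zero    ()
  ⊨-tautology (suc m) ()

-- Blocks of variables and tuples of parameters.

left : ∀ m {n} → Vec (Fin (m + n)) m
left m = map (_↑ˡ _) (Vec.allFin m)

-- The positions of the entries in a `concat` of `k` tuples of length `e`, grouped by tuple.
blocks : ∀ k e → Vec (Vec (Fin (k * e)) e) k
blocks zero    e = []
blocks (suc k) e = left e ∷ map (map (e ↑ʳ_)) (blocks k e)

module _ {a : Level} {A : Set a} where

  lookup-left : ∀ {m n} (u : Vec A m) {v : Vec A n} → map (lookup (u ++ v)) (left m) ≡ u
  lookup-left {m} u {v} = trans (sym (map-∘ _ _ (Vec.allFin m)))
    (trans (map-cong (lookup-++ˡ u v) (Vec.allFin m)) (map-lookup-allFin u))

  lookup-right : ∀ {m n l} (u : Vec A m) {v : Vec A n} (σ : Vec (Fin n) l) →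
    map (lookup (u ++ v)) (map (m ↑ʳ_) σ) ≡ map (lookup v) σ
  lookup-right u {v} σ = trans (sym (map-∘ _ _ σ)) (map-cong (lookup-++ʳ u v) σ)

  lookup-rights : ∀ {m n l k} (u : Vec A m) {v : Vec A n} (σs : Vec (Vec (Fin n) l) k) →
    map (map (lookup (u ++ v))) (map (map (m ↑ʳ_)) σs) ≡ map (map (lookup v)) σs
  lookup-rights u σs = trans (sym (map-∘ _ _ σs)) (map-cong (lookup-right u) σs)

  lookup-blocks : ∀ {k e} (bs : Vec (Vec A e) k) → map (map (lookup (concat bs))) (blocks k e) ≡ bs
  lookup-blocks []       = refl
  lookup-blocks (b ∷ bs) =
    cong₂ _∷_ (lookup-left b) (trans (lookup-rights b (blocks _ _)) (lookup-blocks bs))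

  -- Stated over any `A`, so that the same layout serves for elements of the structure and for
  -- variables in formulas; `map-fibreParams` and `map-baseParams` relate the two under an
  -- assignment.
  fibreParams : ∀ {d e k} → Vec A d → Vec (Vec A e) k → Vec A (k * (d + e))
  fibreParams xs bs = concat (map (xs ++_) bs)

  baseParams : ∀ {e k l} → Vec (Vec A e) k → Vec (Vec A e) l → Vec A (l * (e + k * e))
  baseParams bs cs = concat (map (_++ concat bs) cs)

module _ {a b : Level} {A : Set a} {B : Set b} (f : A → B) where

  map-fibreParams : ∀ {d e k} (xs : Vec A d) (bs : Vec (Vec A e) k) →
    map f (fibreParams xs bs) ≡ fibreParams (map f xs) (map (map f) bs)
  map-fibreParams xs bs = trans (map-concat f (map (xs ++_) bs)) (cong concat
    (trans (sym (map-∘ _ _ bs)) (trans (map-cong (map-++ f xs) bs) (map-∘ _ _ bs))))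

  map-baseParams : ∀ {e k l} (bs : Vec (Vec A e) k) (cs : Vec (Vec A e) l) →
    map f (baseParams bs cs) ≡ baseParams (map (map f) bs) (map (map f) cs)
  map-baseParams bs cs = trans (map-concat f (map (_++ concat bs) cs)) (cong concat
    (trans (sym (map-∘ _ _ cs)) (trans (map-cong
      (λ c → trans (map-++ f c (concat bs)) (cong (map f c ++_) (map-concat f bs))) cs)
      (map-∘ _ _ cs))))

take-++ : ∀ {a} {A : Set a} {m n} (xs : Vec A m) (ys : Vec A n) → take m (xs ++ ys) ≡ xs
take-++ {m = m} xs ys = ++-injectiveˡ _ xs (take++drop≡id m (xs ++ ys))

drop-++ : ∀ {a} {A : Set a} {m n} (xs : Vec A m) (ys : Vec A n) → drop m (xs ++ ys) ≡ ys
drop-++ {m = m} xs ys = ++-injectiveʳ (take m (xs ++ ys)) xs (take++drop≡id m (xs ++ ys))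

-- Lists, tuples over a list and their number.

All-∈-map⁺ : ∀ {a b} {A : Set a} {B : Set b} (f : A → B) {n xs} {ys : Vec A n} →
  All (_∈ xs) ys → All (_∈ List.map f xs) (map f ys)
All-∈-map⁺ f = All.map⁺ ∘ All.map (∈-map⁺ f)

-- Turns parameters taken from `Bᶠ xs` or `Bᵇ bs` back into parameters from `B`.
All-∈-map⁻ : ∀ {a b} {A : Set a} {B : Set b} (f : A → B) {n xs} {ys : Vec B n} →
  All (_∈ List.map f xs) ys → ∃[ zs ] (All (_∈ xs) zs × ys ≡ map f zs)
All-∈-map⁻ f []       = [] , [] , refl
All-∈-map⁻ f (y∈ ∷ p) =
  let z , z∈ , y≡ = ∈-map⁻ f y∈ ; zs , zs∈ , ys≡ = All-∈-map⁻ f p in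
  z ∷ zs , z∈ ∷ zs∈ , cong₂ _∷_ y≡ ys≡

map-≢[] : ∀ {a b} {A : Set a} {B : Set b} (f : A → B) {xs} → xs ≢ [] → List.map f xs ≢ []
map-≢[] f {[]}     xs≢[] = contradiction refl xs≢[]
map-≢[] f {_ ∷ _}  _ ()

length-cartesianProductWith : ∀ {a b c} {A : Set a} {B : Set b} {C : Set c} (f : A → B → C) xs ys →
  length (cartesianProductWith f xs ys) ≡ length xs * length ys
length-cartesianProductWith f []       ys = refl
length-cartesianProductWith f (x ∷ xs) ys = trans (List.length-++ (List.map (f x) ys))
  (cong₂ _+_ (List.length-map (f x) ys) (length-cartesianProductWith f xs ys))

tuples : ∀ {a} {A : Set a} → List A → ∀ k → List (Vec A k)
tuples xs zero    = [] ∷ []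
tuples xs (suc k) = cartesianProductWith _∷_ xs (tuples xs k)

∈-tuples : ∀ {a} {A : Set a} {xs : List A} {k} {ys : Vec A k} → All (_∈ xs) ys → ys ∈ tuples xs k
∈-tuples []       = here refl
∈-tuples (y∈ ∷ p) = ∈-cartesianProductWith⁺ _∷_ y∈ (∈-tuples p)

length-tuples : ∀ {a} {A : Set a} (xs : List A) k → length (tuples xs k) ≡ length xs ^ k
length-tuples xs zero    = refl
length-tuples xs (suc k) =
  trans (length-cartesianProductWith _∷_ xs (tuples xs k)) (cong (length xs *_) (length-tuples xs k))

-- Counting unions of families of subsets.

module _ {a : Level} {A : Set a} where

  -- CardinalityAtMost for families in an arbitrary universe, such as those defined by
  -- quantifying over subsets.
  Enumeration : ∀ {p} → Pred (Pred A a) p → ℕ → Set _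
  Enumeration 𝒮 t = Σ[ Xs ∈ Vec (Pred A a) t ] (∀ Δ → 𝒮 Δ → ∃[ i ] (Δ ≐ lookup Xs i))

  -- A bound with a real exponent is a predicate `P` on counts, not a number that can be summed. The
  -- maximum `m` of the counts still satisfies `P`, and each index contributes at most `m` sets.
  enumerate-⋃ : ∀ {p q i} {I : Set i} (𝒮 : I → Pred (Pred A a) p) (P : Pred ℕ q) →
    P 0 → (∀ {l m} → P l → P m → P (l ⊔ m)) →
    (∀ i → ∃[ t ] (Enumeration (𝒮 i) t × P t)) →
    ∀ is → ∃[ t ] ∃[ m ] (P m × t ≤ length is * m ×
                          Enumeration (λ Δ → ∃[ i ] (i ∈ is × 𝒮 i Δ)) t)
  enumerate-⋃ 𝒮 P P0 P⊔ enum []       = 0 , 0 , P0 , z≤n , [] , λ _ ()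
  enumerate-⋃ 𝒮 P P0 P⊔ enum (i ∷ is)
    with t , (Xs , Xs-complete) , Pt ← enum i
       | t′ , m , Pm , t′≤ , Ys , Ys-complete ← enumerate-⋃ 𝒮 P P0 P⊔ enum is =
    t + t′ , t ⊔ m , P⊔ Pt Pm ,
    +-mono-≤ (m≤m⊔n t m) (≤-trans t′≤ (*-monoʳ-≤ (length is) (m≤n⊔m t m))) ,
    Xs ++ Ys , complete
    where
    complete : ∀ Δ → ∃[ j ] (j ∈ i ∷ is × 𝒮 j Δ) → ∃[ l ] (Δ ≐ lookup (Xs ++ Ys) l)
    complete Δ (_ , here refl , Δ∈) = let l , eq = Xs-complete Δ Δ∈ in
      l ↑ˡ t′ , subst (Δ ≐_) (sym (lookup-++ˡ Xs Ys l)) eq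
    complete Δ (j , there j∈ , Δ∈) = let l , eq = Ys-complete Δ (j , j∈ , Δ∈) in
      t ↑ʳ l , subst (Δ ≐_) (sym (lookup-++ʳ Xs Ys l)) eq

-- Arithmetic of bounds with real exponents.

0≤·^ʳ : ∀ {C m} r → 0 ≤ C · m ^ʳ r
0≤·^ʳ r u v (suc w) _ = z≤n

⊔-≤·^ʳ : ∀ {C m} r {s t} → s ≤ C · m ^ʳ r → t ≤ C · m ^ʳ r → (s ⊔ t) ≤ C · m ^ʳ r
⊔-≤·^ʳ r {s} {t} s≤ t≤ with ⊔-sel s t
... | inj₁ eq rewrite eq = s≤
... | inj₂ eq rewrite eq = t≤

^-distribʳ-* : ∀ o m n → (m * n) ^ o ≡ m ^ o * n ^ o
^-distribʳ-* zero    m n = refl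
^-distribʳ-* (suc o) m n =
  trans (cong (m * n *_) (^-distribʳ-* o m n)) ([m*n]*[o*p]≡[m*o]*[n*p] m n (m ^ o) (n ^ o))

-- Raised to the power `w`, the factor `m ^ k` becomes `m ^ (k * w)` and joins `m ^ v`. This
-- replaces `v` by `v + k * w`, which lowers the rational exponent by `k`; `N` goes into the
-- constant.
≤·^ʳ-* : ∀ {C m k t t₀ r s} N →
  (∀ u v w .{{_ : NonZero w}} → ℝ.Upper s ((u ⊖ v) / w) → ℝ.Upper r ((u ⊖ (v + k * w)) / w)) →
  t ≤ N * m ^ k * t₀ → t₀ ≤ C · m ^ʳ r → t ≤ N * C · m ^ʳ s
≤·^ʳ-* {C} {m} {k} {t} {t₀} N shift t≤ t₀≤ u v w u/w = begin
  t ^ w * m ^ v                                 ≤⟨ *-monoˡ-≤ (m ^ v) (^-monoˡ-≤ w t≤) ⟩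
  (N * m ^ k * t₀) ^ w * m ^ v                  ≡⟨ cong (_* m ^ v) (^-distribʳ-* w (N * m ^ k) t₀) ⟩
  (N * m ^ k) ^ w * t₀ ^ w * m ^ v              ≡⟨ cong (λ z → z * t₀ ^ w * m ^ v) (^-distribʳ-* w N (m ^ k)) ⟩
  N ^ w * (m ^ k) ^ w * t₀ ^ w * m ^ v          ≡⟨ cong (λ z → N ^ w * z * t₀ ^ w * m ^ v) (^-*-assoc m k w) ⟩
  N ^ w * m ^ (k * w) * t₀ ^ w * m ^ v          ≡⟨ rearrange (N ^ w) (m ^ (k * w)) (t₀ ^ w) (m ^ v) ⟩
  N ^ w * (t₀ ^ w * (m ^ v * m ^ (k * w)))      ≡⟨ cong (λ z → N ^ w * (t₀ ^ w * z)) (^-distribˡ-+-* m v (k * w)) ⟨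
  N ^ w * (t₀ ^ w * m ^ (v + k * w))            ≤⟨ *-monoʳ-≤ (N ^ w) (t₀≤ u (v + k * w) w (shift u v w u/w)) ⟩
  N ^ w * (C ^ w * m ^ u)                       ≡⟨ *-assoc (N ^ w) (C ^ w) (m ^ u) ⟨
  N ^ w * C ^ w * m ^ u                         ≡⟨ cong (_* m ^ u) (^-distribʳ-* w N C) ⟨
  (N * C) ^ w * m ^ u                           ∎
  where
  open ≤-Reasoning
  rearrange : ∀ a b c d → a * b * c * d ≡ a * (c * (d * b))
  rearrange = ℕ-solve-∀

toℚᵘ-/ : ∀ i n .{{_ : NonZero n}} → ℚ.toℚᵘ (i / n) ℚᵘ.≃ i ℚᵘ./ n
toℚᵘ-/ i (suc n) = ℚ.toℚᵘ-fromℚᵘ (mkℚᵘ i n)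

toℚᵘ-− : ∀ p q → ℚ.toℚᵘ (p ℚ.- q) ℚᵘ.≃ ℚ.toℚᵘ p ℚᵘ.- ℚ.toℚᵘ q
toℚᵘ-− p q = ℚᵘ.≃-trans (ℚ.toℚᵘ-homo-+ p (ℚ.- q))
  (ℚᵘ.+-congʳ (ℚ.toℚᵘ p) (ℚ.toℚᵘ-homo‿- q))

-- Both sides are `(u - v) / w - k - m`. The computation is done with unnormalised fractions, since
-- `_/_` cancels common factors.
shift-numerator : ∀ k m u v w .{{_ : NonZero w}} →
  (u ⊖ v) / w ℚ.- + (k + m) / 1 ≡ (u ⊖ (v + k * w)) / w ℚ.- + m / 1
shift-numerator k m u v w@(suc w-1) = ℚ.toℚᵘ-injective (begin
  ℚ.toℚᵘ ((u ⊖ v) / w ℚ.- + (k + m) / 1)              ≈⟨ unnormalise (u ⊖ v) (k + m) ⟩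
  mkℚᵘ (u ⊖ v) w-1 ℚᵘ.- mkℚᵘ (+ (k + m)) 0            ≈⟨ *≡* (cong (ℤ._* + (w * 1)) numerators) ⟩
  mkℚᵘ (u ⊖ (v + k * w)) w-1 ℚᵘ.- mkℚᵘ (+ m) 0        ≈⟨ unnormalise (u ⊖ (v + k * w)) m ⟨
  ℚ.toℚᵘ ((u ⊖ (v + k * w)) / w ℚ.- + m / 1)          ∎)
  where
  open ℚᵘ.≃-Reasoning
  unnormalise : ∀ i n → ℚ.toℚᵘ (i / w ℚ.- + n / 1) ℚᵘ.≃ mkℚᵘ i w-1 ℚᵘ.- mkℚᵘ (+ n) 0
  unnormalise i n = ℚᵘ.≃-trans (toℚᵘ-− (i / w) (+ n / 1))
    (ℚᵘ.+-cong (toℚᵘ-/ i w) (ℚᵘ.-‿cong (toℚᵘ-/ (+ n) 1)))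
  subtract : ∀ u v z → u ℤ.- (v ℤ.+ z) ≡ u ℤ.- v ℤ.- z
  subtract = ℤ-solve-∀
  difference : u ⊖ (v + k * w) ≡ (u ⊖ v) ℤ.- + k ℤ.* + w
  difference = trans (sym (ℤ.m-n≡m⊖n u (v + k * w))) (trans (subtract (+ u) (+ v) (+ (k * w)))
    (cong₂ ℤ._-_ (ℤ.m-n≡m⊖n u v) (ℤ.pos-* k w)))
  collect : ∀ i k m w →
    i ℤ.* + 1 ℤ.+ (ℤ.- (k ℤ.+ m)) ℤ.* w ≡ (i ℤ.- k ℤ.* w) ℤ.* + 1 ℤ.+ (ℤ.- m) ℤ.* w
  collect = ℤ-solve-∀
  numerators : (u ⊖ v) ℤ.* + 1 ℤ.+ (ℤ.- + (k + m)) ℤ.* + w ≡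
    (u ⊖ (v + k * w)) ℤ.* + 1 ℤ.+ (ℤ.- + m) ℤ.* + w
  numerators = trans (collect (u ⊖ v) (+ k) (+ m) (+ w))
    (cong (λ z → z ℤ.* + 1 ℤ.+ (ℤ.- + m) ℤ.* + w) (sym difference))

-- The order is defined by lower cuts but the bounds use upper cuts. Openness gives `p` strictly
-- between `s` and `q`; locating `r` against `p` and `q` leaves only `r < q`, as `p < r` would give
-- `p < s`.
≤ʳ⇒Upper : ∀ {r s} → r ≤ʳ s → ∀ {q} → ℝ.Upper s q → ℝ.Upper r q
≤ʳ⇒Upper {r} {s} r≤s s<q with p , p<q , s<p ← ℝ.upper-open s s<q | ℝ.located r p<q
... | inj₁ p<r = contradiction s<p (ℝ.disjoint s (r≤s p<r))
... | inj₂ r<q = r<q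

-- Fibre cells and the formulas to decompose on the base.

module Fibring {ℓ a : Level} {𝓛 : Language ℓ} (𝓜 : Structure 𝓛 a) (d e : ℕ)
  (Φ : List (Formula 𝓛 (suc d + e))) (T₁ : DistalCellDecomposition 𝓜 1 (d + e) Φ) where

  open Structure 𝓜 using () renaming (Universe to M)

  private
    infix 4 _⊩_
    _⊩_ : ∀ {n} → Vec M n → Formula 𝓛 n → Set a
    _⊩_ = _⊨_ 𝓜

  private module T₁ = DistalCellDecomposition T₁

  k : ℕ
  k = T₁.parameters

  -- `1 + (d + e)` and `suc d + e` agree definitionally, so `Φ` itself serves the fibres: `xs` moves
  -- from the variables to the front of every parameter.
  Cell₁ : Fin T₁.size → M → Vec M d → Vec (Vec M e) k → Set a
  Cell₁ i x xs bs = x ∷ fibreParams xs bs ⊩ T₁.ψ i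

  Excl₁ : Fin T₁.size → Vec M d → Vec M e → Vec (Vec M e) k → Set a
  Excl₁ i xs b bs = (xs ++ b) ++ fibreParams xs bs ⊩ T₁.θ i

  module _ {n : ℕ} where

    -- The variable positions are left open because the same formula occurs in the base formulas
    -- and, under another layout of variables, in the new scheme.
    cell₁ : Fin T₁.size → Fin n → Vec (Fin n) d → Vec (Vec (Fin n) e) k → Formula 𝓛 n
    cell₁ i x xs bs = rename (x ∷ fibreParams xs bs) (T₁.ψ i)

    excl₁ : Fin T₁.size → Vec (Fin n) d → Vec (Fin n) e → Vec (Vec (Fin n) e) k → Formula 𝓛 n
    excl₁ i xs b bs = rename ((xs ++ b) ++ fibreParams xs bs) (T₁.θ i)

    module _ {ρ : Vec M n} where

      ⊨-cell₁ : ∀ i {x xs bs x′ xs′ bs′} →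
        lookup ρ x ≡ x′ → map (lookup ρ) xs ≡ xs′ → map (map (lookup ρ)) bs ≡ bs′ →
        ρ ⊩ cell₁ i x xs bs ⇔ Cell₁ i x′ xs′ bs′
      ⊨-cell₁ i {x} {xs} {bs} refl refl refl =
        ⊨-rename 𝓜 (cong (lookup ρ x ∷_) (map-fibreParams (lookup ρ) xs bs)) (T₁.ψ i)

      ⊨-excl₁ : ∀ i {xs b bs xs′ b′ bs′} →
        map (lookup ρ) xs ≡ xs′ → map (lookup ρ) b ≡ b′ → map (map (lookup ρ)) bs ≡ bs′ →
        ρ ⊩ excl₁ i xs b bs ⇔ Excl₁ i xs′ b′ bs′
      ⊨-excl₁ i {xs} {b} {bs} refl refl refl = ⊨-rename 𝓜
        (trans (map-++ (lookup ρ) (xs ++ b) _)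
          (cong₂ _++_ (map-++ (lookup ρ) xs b) (map-fibreParams (lookup ρ) xs bs))) (T₁.θ i)

  -- For a fibre cell, which φ does not cross, failing to meet φ means being disjoint from it, so
  -- no second formula for containment in φ is needed.
  Meets : Fin T₁.size → Formula 𝓛 (suc d + e) → Vec M d → Vec M e → Vec (Vec M e) k → Set a
  Meets i φ xs b bs = ∃[ x ] (Cell₁ i x xs bs × (x ∷ xs ++ b ⊩ φ))

  -- `c` counts the variables before those of the parameters: `d` in `excl`, and `suc d` under the
  -- quantifier of `meets`.
  varsˣ : ∀ c → Vec (Fin (c + (e + k * e))) c
  varsˣ c = left c

  varsᵇ : ∀ c → Vec (Fin (c + (e + k * e))) e
  varsᵇ c = map (c ↑ʳ_) (left e)

  varsᵇˢ : ∀ c → Vec (Vec (Fin (c + (e + k * e))) e) k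
  varsᵇˢ c = map (map (c ↑ʳ_)) (map (map (e ↑ʳ_)) (blocks k e))

  excl : Fin T₁.size → Formula 𝓛 (d + (e + k * e))
  excl i = excl₁ i (varsˣ d) (varsᵇ d) (varsᵇˢ d)

  meets : Fin T₁.size → Formula 𝓛 (suc d + e) → Formula 𝓛 (d + (e + k * e))
  meets i φ = ∃′ (cell₁ i (head xs) (tail xs) (varsᵇˢ (suc d)) ∧′
                  rename (xs ++ varsᵇ (suc d)) φ)
    where xs = varsˣ (suc d)

  module _ {c} (xs : Vec M c) (b : Vec M e) (bs : Vec (Vec M e) k) where

    lookup-varsᵇ : map (lookup (xs ++ (b ++ concat bs))) (varsᵇ c) ≡ b
    lookup-varsᵇ = trans (lookup-right xs (left e)) (lookup-left b)

    lookup-varsᵇˢ : map (map (lookup (xs ++ (b ++ concat bs)))) (varsᵇˢ c) ≡ bs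
    lookup-varsᵇˢ = trans (lookup-rights xs (map (map (e ↑ʳ_)) (blocks k e)))
      (trans (lookup-rights b (blocks k e)) (lookup-blocks bs))

  ⊨-excl : ∀ i xs b bs → xs ++ (b ++ concat bs) ⊩ excl i ⇔ Excl₁ i xs b bs
  ⊨-excl i xs b bs = ⊨-excl₁ i (lookup-left xs) (lookup-varsᵇ xs b bs) (lookup-varsᵇˢ xs b bs)

  ⊨-meets : ∀ i φ xs b bs → xs ++ (b ++ concat bs) ⊩ meets i φ ⇔ Meets i φ xs b bs
  ⊨-meets i φ xs b bs = mk⇔ (map₂ λ {x} → to (body x)) (map₂ λ {x} → from (body x))
    where
    body : ∀ x → x ∷ xs ++ (b ++ concat bs) ⊩
        cell₁ i (head (varsˣ (suc d))) (tail (varsˣ (suc d))) (varsᵇˢ (suc d))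
          ∧′ rename (varsˣ (suc d) ++ varsᵇ (suc d)) φ
      ⇔ (Cell₁ i x xs bs × (x ∷ xs ++ b ⊩ φ))
    body x =
      ⊨-cell₁ i refl (cong tail (lookup-left (x ∷ xs))) (lookup-varsᵇˢ (x ∷ xs) b bs) ×-⇔
      ⊨-rename 𝓜 (trans (map-++ _ (varsˣ (suc d)) (varsᵇ (suc d)))
        (cong₂ _++_ (lookup-left (x ∷ xs)) (lookup-varsᵇ (x ∷ xs) b bs))) φ

  baseFormulas : List (Formula 𝓛 (d + (e + k * e)))
  baseFormulas = List.map excl (allFin T₁.size) List.++ cartesianProductWith meets (allFin T₁.size) Φ

  excl∈ : ∀ i → excl i ∈ baseFormulas
  excl∈ i = ∈-++⁺ˡ (∈-map⁺ excl (∈-allFin i))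

  meets∈ : ∀ i {φ} → φ ∈ Φ → meets i φ ∈ baseFormulas
  meets∈ i φ∈ = ∈-++⁺ʳ (List.map excl (allFin T₁.size)) (∈-cartesianProductWith⁺ meets (∈-allFin i) φ∈)

  -- The combined cell scheme in one more variable.

  module Total (T₂ : DistalCellDecomposition 𝓜 d (e + k * e) baseFormulas) where

    private module T₂ = DistalCellDecomposition T₂

    Cell₂ : Fin T₂.size → Vec (Vec M e) k → Vec (Vec M e) T₂.parameters → Pred (Vec M d) a
    Cell₂ j bs cs xs = xs ++ baseParams bs cs ⊩ T₂.ψ j

    Excl₂ : Fin T₂.size → Vec M e → Vec (Vec M e) k → Vec (Vec M e) T₂.parameters → Set a
    Excl₂ j b bs cs = (b ++ concat bs) ++ baseParams bs cs ⊩ T₂.θ j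

    module _ {n : ℕ} where

      cell₂ : Fin T₂.size → Vec (Fin n) d →
        Vec (Vec (Fin n) e) k → Vec (Vec (Fin n) e) T₂.parameters → Formula 𝓛 n
      cell₂ j xs bs cs = rename (xs ++ baseParams bs cs) (T₂.ψ j)

      excl₂ : Fin T₂.size → Vec (Fin n) e →
        Vec (Vec (Fin n) e) k → Vec (Vec (Fin n) e) T₂.parameters → Formula 𝓛 n
      excl₂ j b bs cs = rename ((b ++ concat bs) ++ baseParams bs cs) (T₂.θ j)

      module _ {ρ : Vec M n} where

        ⊨-cell₂ : ∀ j {xs bs cs xs′ bs′ cs′} →
          map (lookup ρ) xs ≡ xs′ → map (map (lookup ρ)) bs ≡ bs′ → map (map (lookup ρ)) cs ≡ cs′ →
          ρ ⊩ cell₂ j xs bs cs ⇔ Cell₂ j bs′ cs′ xs′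
        ⊨-cell₂ j {xs} {bs} {cs} refl refl refl = ⊨-rename 𝓜
          (trans (map-++ (lookup ρ) xs _) (cong (map (lookup ρ) xs ++_) (map-baseParams (lookup ρ) bs cs))) (T₂.ψ j)

        ⊨-excl₂ : ∀ j {b bs cs b′ bs′ cs′} →
          map (lookup ρ) b ≡ b′ → map (map (lookup ρ)) bs ≡ bs′ → map (map (lookup ρ)) cs ≡ cs′ →
          ρ ⊩ excl₂ j b bs cs ⇔ Excl₂ j b′ bs′ cs′
        ⊨-excl₂ j {b} {bs} {cs} refl refl refl = ⊨-rename 𝓜
          (trans (map-++ (lookup ρ) (b ++ concat bs) _)
            (cong₂ _++_ (trans (map-++ (lookup ρ) b _) (cong (map (lookup ρ) b ++_) (map-concat (lookup ρ) bs)))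
              (map-baseParams (lookup ρ) bs cs))) (T₂.θ j)

    -- The first `k` tuples, `bs`, determine the fibre cells; the others, `cs`, pick a cell of the
    -- base decomposition over `Bᵇ bs`.
    K : ℕ
    K = k + T₂.parameters

    size : ℕ
    size = T₁.size * T₂.size

    fibreIndex : Fin size → Fin T₁.size
    fibreIndex n = proj₁ (remQuot {T₁.size} T₂.size n)

    baseIndex : Fin size → Fin T₂.size
    baseIndex n = proj₂ (remQuot {T₁.size} T₂.size n)

    -- The existential form lets `covers` match both equations with `refl`.
    index : ∀ i j → ∃[ n ] (fibreIndex n ≡ i × baseIndex n ≡ j)
    index i j = combine i j , cong proj₁ (remQuot-combine i j) , cong proj₂ (remQuot-combine i j)

    params : ∀ c → Vec (Vec (Fin (c + K * e)) e) K
    params c = map (map (c ↑ʳ_)) (blocks K e)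

    ψ : Fin size → Formula 𝓛 (suc d + K * e)
    ψ n = tautology (toℕ n) ∧′
      (cell₂ (baseIndex n) (tail xs) bs cs ∧′ cell₁ (fibreIndex n) (head xs) (tail xs) bs)
      where
      xs = left (suc d)
      bs = take k (params (suc d))
      cs = drop k (params (suc d))

    -- Rejecting a cylinder as soon as one fibre over the base cell is excluded makes kept cylinders
    -- kept in every fibre. Coverage survives because `excl` does not cross base cells: a fibre cell
    -- kept at one point is kept at all.
    θ : Fin size → Formula 𝓛 (e + K * e)
    θ n = excl₂ (baseIndex n) (left e) (take k (params e)) (drop k (params e)) ∨′
      ∃′* d (cell₂ (baseIndex n) (left d) bs cs ∧′
             excl₁ (fibreIndex n) (left d) (map (d ↑ʳ_) (left e)) bs)
      where
      bs = take k (map (map (d ↑ʳ_)) (params e))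
      cs = drop k (map (map (d ↑ʳ_)) (params e))

    scheme : CellScheme 𝓜 (suc d) e
    scheme = record
      { parameters  = K
      ; size        = size
      ; ψ           = ψ
      ; ψ-injective = toℕ-injective ∘ tautology-injective _ _ ∘ ∧′-injectiveˡ
      ; θ           = θ
      }

    lookup-take : ∀ {n} (ρ : Vec M n) {σs : Vec (Vec (Fin n) e) K} bs {cs} →
      map (map (lookup ρ)) σs ≡ bs ++ cs → map (map (lookup ρ)) (take k σs) ≡ bs
    lookup-take ρ bs eq = trans (sym (take-map _ k _)) (trans (cong (take k) eq) (take-++ bs _))

    lookup-drop : ∀ {n} (ρ : Vec M n) {σs : Vec (Vec (Fin n) e) K} bs {cs} →
      map (map (lookup ρ)) σs ≡ bs ++ cs → map (map (lookup ρ)) (drop k σs) ≡ cs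
    lookup-drop ρ bs eq = trans (sym (drop-map _ k _)) (trans (cong (drop k) eq) (drop-++ bs _))

    lookup-params : ∀ {c} (u : Vec M c) (bs : Vec (Vec M e) K) →
      map (map (lookup (u ++ concat bs))) (params c) ≡ bs
    lookup-params u bs = trans (lookup-rights u (blocks K e)) (lookup-blocks bs)

    ⊨-ψ : ∀ n x xs bs cs → x ∷ xs ++ concat (bs ++ cs) ⊩ ψ n ⇔
      (Cell₂ (baseIndex n) bs cs xs × Cell₁ (fibreIndex n) x xs bs)
    ⊨-ψ n x xs bs cs = mk⇔ (to body ∘ proj₂) (λ h → ⊨-tautology 𝓜 (toℕ n) , from body h)
      where
      ρ = x ∷ xs ++ concat (bs ++ cs)
      eq = lookup-params (x ∷ xs) (bs ++ cs)
      body = ⊨-cell₂ (baseIndex n) (cong tail (lookup-left (x ∷ xs)))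
          (lookup-take ρ bs eq) (lookup-drop ρ bs eq)
        ×-⇔ ⊨-cell₁ (fibreIndex n) refl (cong tail (lookup-left (x ∷ xs))) (lookup-take ρ bs eq)

    ⊨-θ : ∀ n b bs cs → b ++ concat (bs ++ cs) ⊩ θ n ⇔
      (Excl₂ (baseIndex n) b bs cs ⊎
       ∃[ xs ] (Cell₂ (baseIndex n) bs cs xs × Excl₁ (fibreIndex n) xs b bs))
    ⊨-θ n b bs cs =
      ⊨-excl₂ (baseIndex n) (lookup-left b) (lookup-take ρ bs eq) (lookup-drop ρ bs eq) ⊎-⇔
      (mk⇔ (map₂ λ {xs} → to (body xs)) (map₂ λ {xs} → from (body xs)) ⇔-∘ ⊨-∃′* 𝓜 d _)
      where
      ρ = b ++ concat (bs ++ cs)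
      eq = lookup-params b (bs ++ cs)
      body = λ (xs : Vec M d) → let eq′ = trans (lookup-rights xs (params e)) eq in
        ⊨-cell₂ (baseIndex n) (lookup-left xs) (lookup-take (xs ++ ρ) bs eq′)
          (lookup-drop (xs ++ ρ) bs eq′)
        ×-⇔ ⊨-excl₁ (fibreIndex n) (lookup-left xs)
              (trans (lookup-right xs (left e)) (lookup-left b)) (lookup-take (xs ++ ρ) bs eq′)

    -- The cylinders cover and are not crossed.

    module _ (B : List (Vec M e)) where

      Bᶠ : Vec M d → List (Vec M (d + e))
      Bᶠ xs = List.map (xs ++_) B

      Bᵇ : Vec (Vec M e) k → List (Vec M (e + k * e))
      Bᵇ bs = List.map (_++ concat bs) B

      module _ {n} {bs : Vec (Vec M e) k} {cs : Vec (Vec M e) T₂.parameters}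
        (bs∈ : All (_∈ B) bs) (cs∈ : All (_∈ B) cs)
        (kept : ∀ b → b ∈ B → ¬ (b ++ concat (bs ++ cs) ⊩ θ n)) where

        base-cell : T₂.cells (Bᵇ bs) (Cell₂ (baseIndex n) bs cs)
        base-cell = baseIndex n , _ , All-∈-map⁺ _ cs∈ , kept₂ , id , id
          where
          kept₂ : ∀ b′ → b′ ∈ Bᵇ bs → ¬ (b′ ++ baseParams bs cs ⊩ T₂.θ (baseIndex n))
          kept₂ b′ b′∈ h with b , b∈ , refl ← ∈-map⁻ _ b′∈ = kept b b∈ (from (⊨-θ n b bs cs) (inj₁ h))

        -- The second disjunct of `θ` fails for every `b`, which rules out exclusion over each point
        -- `xs` of the base cell.
        fibre-cell : ∀ {xs} → Cell₂ (baseIndex n) bs cs xs →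
          T₁.cells (Bᶠ xs) (λ v → v ++ fibreParams xs bs ⊩ T₁.ψ (fibreIndex n))
        fibre-cell {xs} h₂ = fibreIndex n , _ , All-∈-map⁺ _ bs∈ , kept₁ , id , id
          where
          kept₁ : ∀ b′ → b′ ∈ Bᶠ xs → ¬ (b′ ++ fibreParams xs bs ⊩ T₁.θ (fibreIndex n))
          kept₁ b′ b′∈ h with b , b∈ , refl ← ∈-map⁻ _ b′∈ =
            kept b b∈ (from (⊨-θ n b bs cs) (inj₂ (xs , h₂ , h)))

      module _ (B! : Unique B) (B≢[] : B ≢ []) where

        Bᶠ! : ∀ xs → Unique (Bᶠ xs)
        Bᶠ! xs = Unique.map⁺ (++-injectiveʳ xs xs) B!

        Bᵇ! : ∀ bs → Unique (Bᵇ bs)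
        Bᵇ! bs = Unique.map⁺ (++-injectiveˡ _ _) B!

        -- Suppose `φ` at `b` holds at `x ∷ xs` and fails at `y ∷ ys`. The fibre over `xs` meets
        -- `φ`, whereas the one over `ys` is uncrossed and contains `y`, so it misses `φ`. Hence
        -- `meets` would cross the base cell.
        uncrossed : ∀ Δ → CellScheme.cells scheme B Δ → ¬ Crossed 𝓜 (suc d) e Φ B Δ
        uncrossed Δ (n , as , as∈ , kept , Δ⊆ , _)
                  (φ , b , φ∈ , b∈ , (x ∷ xs , x∈Δ , x∈φ) , (y ∷ ys , y∈Δ , y∉φ))
          with bs , cs , refl ← Vec.splitAt k as
          with bs∈ , cs∈ ← All.++⁻ bs as∈
          with xs∈ , x∈ ← to (⊨-ψ n x xs bs cs) (Δ⊆ x∈Δ)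
             | ys∈ , y∈ ← to (⊨-ψ n y ys bs cs) (Δ⊆ y∈Δ) =
          T₂.uncrossed (Bᵇ bs) (Bᵇ! bs) (map-≢[] _ B≢[]) _ (base-cell bs∈ cs∈ kept)
            ( meets (fibreIndex n) φ , b ++ concat bs , meets∈ _ φ∈ , ∈-map⁺ _ b∈
            , (xs , xs∈ , from (⊨-meets (fibreIndex n) φ xs b bs) (x , x∈ , x∈φ))
            , (ys , ys∈ , λ h → ys-misses (to (⊨-meets (fibreIndex n) φ ys b bs) h)))
          where
          ys-misses : ¬ Meets (fibreIndex n) φ ys b bs
          ys-misses (z , z∈ , z∈φ) =
            T₁.uncrossed (Bᶠ ys) (Bᶠ! ys) (map-≢[] _ B≢[]) _ (fibre-cell bs∈ cs∈ kept ys∈)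
              ( φ , ys ++ b , φ∈ , ∈-map⁺ _ b∈ , (z ∷ [] , z∈ , z∈φ) , (y ∷ [] , y∈ , y∉φ))

        -- The fibre cell around `x` comes first: it supplies `bs`, and only then is there a base
        -- decomposition, over `Bᵇ bs`, in which to look for the cell around `xs`.
        covers : ∀ v → ∃[ Δ ] (CellScheme.cells scheme B Δ × Δ v)
        covers (x ∷ xs)
          with Δ₁ , (i , as , as∈ , kept₁ , Δ₁⊆ , _) , x∈Δ₁ ←
            T₁.covers (Bᶠ xs) (Bᶠ! xs) (map-≢[] _ B≢[]) (x ∷ [])
          with bs , bs∈ , refl ← All-∈-map⁻ _ as∈
          with Δ₂ , (j , as′ , as′∈ , kept₂ , Δ₂⊆ , Δ₂⊇) , xs∈Δ₂ ←
            T₂.covers (Bᵇ bs) (Bᵇ! bs) (map-≢[] _ B≢[]) xs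
          with cs , cs∈ , refl ← All-∈-map⁻ _ as′∈
          with n , refl , refl ← index i j =
          _ , (n , bs ++ cs , All.++⁺ bs∈ cs∈ , kept , id , id) ,
          from (⊨-ψ n x xs bs cs) (Δ₂⊆ xs∈Δ₂ , Δ₁⊆ x∈Δ₁)
          where
          kept : ∀ b → b ∈ B → ¬ (b ++ concat (bs ++ cs) ⊩ θ n)
          kept b b∈ h with to (⊨-θ n b bs cs) h
          ... | inj₁ h₂ = kept₂ (b ++ concat bs) (∈-map⁺ _ b∈) h₂
          -- The fibre cell would be excluded by `b` over `ys` but not over `xs`, so `excl` would
          -- cross `Δ₂`.
          ... | inj₂ (ys , ys∈ , h₁) = T₂.uncrossed (Bᵇ bs) (Bᵇ! bs) (map-≢[] _ B≢[]) Δ₂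
            (baseIndex n , _ , as′∈ , kept₂ , Δ₂⊆ , Δ₂⊇)
            ( excl (fibreIndex n) , b ++ concat bs , excl∈ _ , ∈-map⁺ _ b∈
            , (ys , Δ₂⊇ ys∈ , from (⊨-excl (fibreIndex n) ys b bs) h₁)
            , (xs , xs∈Δ₂ , λ h → kept₁ (xs ++ b) (∈-map⁺ _ b∈) (to (⊨-excl (fibreIndex n) xs b bs) h)))

    decomposition : DistalCellDecomposition 𝓜 (suc d) e Φ
    decomposition = record { scheme = scheme ; covers = covers ; uncrossed = uncrossed }

    -- Counting the cylinders.

    hasExponent : ∀ {r s} →
      (∀ u v w .{{_ : NonZero w}} → ℝ.Upper s ((u ⊖ v) / w) → ℝ.Upper r ((u ⊖ (v + k * w)) / w)) →
      HasExponent 𝓜 d (e + k * e) T₂ r → HasExponent 𝓜 (suc d) e decomposition s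
    hasExponent {r} {s} shift (C , bound) = T₁.size * C , bound′
      where
      module _ (B : List (Vec M e)) (B! : Unique B) (B≢[] : B ≢ []) where

        labels : List (Fin T₁.size × Vec (Vec M e) k)
        labels = cartesianProduct (allFin T₁.size) (tuples B k)

        length-labels : length labels ≡ T₁.size * length B ^ k
        length-labels = trans (length-cartesianProductWith _,_ (allFin T₁.size) (tuples B k))
          (cong₂ _*_ (List.length-tabulate {n = T₁.size} id) (length-tuples B k))

        _over_ : Pred (Vec M d) a → Fin T₁.size × Vec (Vec M e) k → Pred (Vec M (suc d)) a
        (Δ₂ over (i , bs)) v = Δ₂ (tail v) × Cell₁ i (head v) (tail v) bs

        -- All cylinders with label `l` over base cells, whether or not their fibres are kept: for
        -- an upper bound the list may contain extra sets.
        cellsOver : Fin T₁.size × Vec (Vec M e) k → Pred (Pred (Vec M (suc d)) a) _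
        cellsOver l@(_ , bs) Δ = ∃[ Δ₂ ] (T₂.cells (Bᵇ B bs) Δ₂ × Δ ≐ (Δ₂ over l))

        over-cong : ∀ {l Δ Δ₂ Δ₂′} → Δ ≐ (Δ₂ over l) → Δ₂ ≐ Δ₂′ → Δ ≐ (Δ₂′ over l)
        over-cong (⊆ , ⊇) (⊆′ , ⊇′) = (λ h → map₁ ⊆′ (⊆ h)) , λ h → ⊇ (map₁ ⊇′ h)

        enumerate : ∀ l → ∃[ t ] (Enumeration (cellsOver l) t × t ≤ C · length B ^ʳ r)
        enumerate l@(_ , bs)
          with t , (Δs , complete) , t≤ ← bound (Bᵇ B bs) (Bᵇ! B B! B≢[] bs) (map-≢[] _ B≢[]) =
          t , (map (_over l) Δs , λ Δ (Δ₂ , Δ₂∈ , eq) → let m , eq₂ = complete Δ₂ Δ₂∈ in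
            m , subst (Δ ≐_) (sym (lookup-map m (_over l) Δs)) (over-cong {l} eq eq₂)) ,
          -- `Bᵇ B bs` has the length of `B`, so the bound is the same for every label.
          subst (t ≤ C ·_^ʳ r) (List.length-map (_++ concat bs) B) t≤

        cell⇒cellOver : ∀ Δ → CellScheme.cells scheme B Δ → ∃[ l ] (l ∈ labels × cellsOver l Δ)
        cell⇒cellOver Δ (n , as , as∈ , kept , Δ⊆ , Δ⊇)
          with bs , cs , refl ← Vec.splitAt k as
          with bs∈ , cs∈ ← All.++⁻ bs as∈ =
          (fibreIndex n , bs) , ∈-cartesianProduct⁺ (∈-allFin _) (∈-tuples bs∈) ,
          _ , base-cell B bs∈ cs∈ kept ,
          (λ { {x ∷ xs} h → to (⊨-ψ n x xs bs cs) (Δ⊆ h) }) ,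
          (λ { {x ∷ xs} h → Δ⊇ (from (⊨-ψ n x xs bs cs) h) })

        bound′ : ∃[ t ] (CardinalityAtMost (CellScheme.cells scheme B) t ×
                         t ≤ T₁.size * C · length B ^ʳ s)
        bound′ with t , t₀ , t₀≤ , t≤ , Δs , complete ←
            enumerate-⋃ cellsOver (_≤ C · length B ^ʳ r) (0≤·^ʳ r) (⊔-≤·^ʳ r) enumerate labels =
          t , (Δs , λ Δ → complete Δ ∘ cell⇒cellOver Δ) ,
          -- Of the `T₁.size * length B ^ k` labels, the first factor enters the constant and the
          -- second raises the exponent by `k`.
          ≤·^ʳ-* {k = k} {r = r} {s} T₁.size shift (subst (λ N → t ≤ N * t₀) length-labels t≤) t₀≤

-- Induction on the number of added coordinates.

theorem3p1 : ∀ {ℓ a} {𝓛 : Language ℓ} (𝓜 : Structure 𝓛 a) (k d₀ : ℕ) (r : ℝ) →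
    (∀ e (Φ : List (Formula 𝓛 (1 + e))) →
    Σ[ T ∈ DistalCellDecomposition 𝓜 1 e Φ ] HasParameters 𝓜 1 e T k) →
    (∀ e (Φ : List (Formula 𝓛 (d₀ + e))) →
    Σ[ T ∈ DistalCellDecomposition 𝓜 d₀ e Φ ] HasExponentAtMost 𝓜 d₀ e T r) →
    ∀ d → d₀ ≤ d → ∀ e (Φ : List (Formula 𝓛 (d + e))) →
    Σ[ T ∈ DistalCellDecomposition 𝓜 d e Φ ] HasExponent 𝓜 d e T ((k * (d ∸ d₀)) +ʳ r)
theorem3p1 {𝓛 = 𝓛} 𝓜 k d₀ r unary base d d₀≤d = subst Goal (m∸n+n≡m d₀≤d) (induct (d ∸ d₀))
  where
  -- All `e` and `Φ` are included because the inductive step applies the hypothesis to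
  -- `baseFormulas`, with parameters of length `e + k * e`.
  Goal : ℕ → Set _
  Goal d = ∀ e (Φ : List (Formula 𝓛 (d + e))) →
    Σ[ T ∈ DistalCellDecomposition 𝓜 d e Φ ] HasExponent 𝓜 d e T ((k * (d ∸ d₀)) +ʳ r)

  shift : ∀ j u v w .{{_ : NonZero w}} → ℝ.Upper ((k * (suc j + d₀ ∸ d₀)) +ʳ r) ((u ⊖ v) / w) →
    ℝ.Upper ((k * (j + d₀ ∸ d₀)) +ʳ r) ((u ⊖ (v + k * w)) / w)
  -- The dimension differences become `j` and `suc j`, and `k * suc j` splits as `k + k * j`.
  shift j u v w rewrite m+n∸n≡m j d₀ | m+n∸n≡m (suc j) d₀ | *-suc k j =
    subst (ℝ.Upper r) (shift-numerator k (k * j) u v w)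

  induct : ∀ j → Goal (j + d₀)
  induct zero e Φ with T , r′ , r′≤r , C , bound ← base e Φ =
    T , C , λ B B! B≢[] → let t , enum , t≤ = bound B B! B≢[] in
      -- Every rational above `r` is above `r′`, so the bound for `r′` gives the one for `r`.
      t , enum , λ u v w r<q → t≤ u v w (≤ʳ⇒Upper {r′} {r} r′≤r (unshift r<q))
    where
    unshift : ∀ {q} → ℝ.Upper ((k * (d₀ ∸ d₀)) +ʳ r) q → ℝ.Upper r q
    unshift {q} rewrite n∸n≡0 d₀ | *-zeroʳ k = subst (ℝ.Upper r) (ℚ.+-identityʳ q)
  induct (suc j) e Φ with unary (j + d₀ + e) Φ
  -- Matching `refl` identifies `k` with the number of parameters of `T₁`, hence with the power of
  -- `length B` gained in this step.
  ... | T₁ , refl with T₂ , exponent ← induct j (e + k * e) (Fibring.baseFormulas 𝓜 (j + d₀) e Φ T₁) =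
    decomposition , hasExponent {(k * (j + d₀ ∸ d₀)) +ʳ r} {(k * (suc j + d₀ ∸ d₀)) +ʳ r} (shift j) exponent
    where open Fibring.Total 𝓜 (j + d₀) e Φ T₁ T₂
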